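{- Let $n\ge1$ and let $K$ be a pure $n$-simplicial complex with $p$ vertices. Then $K$ is a simplicial tree if and only if: (1) there is some $0\le m\le n-1$ such that $K$ has no $(m,n)$-simplicial cycle sequences; (2) $\alpha_{n-1}(K)=(p-n)n+1$; and (3) $\alpha_n(K)=p-n$.
   Context: A simplicial complex on a finite vertex set is a collection of non-empty vertex subsets containing all singletons and closed under non-empty subsets; a $k$-simplex has $k+1$ vertices; $\tau$ is a face of $\sigma$ if $\tau\subseteq\sigma$; $\alpha_k(K)$ is the number of $k$-simplices of $K$. $K$ is a pure $n$-simplicial complex if $\dim K=n$ and every simplex is a face of some $n$-simplex. Let $0\le m\le n-1$. An $(m,n)$-walk sequence is an alternating sequence $\sigma_1,\eta_1,\sigma_2,\dots,\sigma_r,\eta_r,\sigma_{r+1}$ of $m$-simplices $\sigma_k$ and $n$-simplices $\eta_k$ with $\sigma_k\ne\sigma_{k+1}$ both faces of $\eta_k$; it is an $(m,n)$-path sequence if all its simplices are distinct. $K$ is connected if there is an $(n-1,n)$-path sequence between every pair of distinct $(n-1)$-simplices. An $(m,n)$-simplicial cycle sequence is an $(m,n)$-walk sequence with $\sigma_{r+1}=\sigma_1$, $\sigma_p\ne\sigma_q$ and $\eta_p\ne\eta_q$ for $1\le p\ne q\le r$, such that $r\ge3$, $\sigma_1$ is not a face of $\eta_k$ for $2\le k\le r-1$, and for each $2\le z\le r$ there is an $(n-1)$-simplex $\sigma'_z$ which is a face of $\eta_{z-1}$ and $\eta_z$ and has $\sigma_z$ as a face, with the $\sigma'_z$ pairwise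 distinct. $K$ is acyclic if it contains no $(m,n)$-simplicial cycle sequence for any $0\le m\le n-1$. A simplicial tree is a connected acyclic pure $n$-simplicial complex. -}

module Defs where

open import Data.Nat using (ℕ; zero; suc; _+_; _*_; _∸_; _≤_; _<_; _≟_)
open import Data.Product using (Σ; ∃; _×_; _,_)
open import Data.Fin using (Fin)
open import Data.Fin.Subset using (Subset; _⊆_; ∣_∣; ⁅_⁆; Nonempty)
open import Data.List using (List; length; filter)
open import Data.List.Relation.Unary.All using (All)
open import Data.List.Relation.Unary.Unique.Propositional using (Unique)
open import Data.List.Membership.Propositional using () renaming (_∈_ to _∈ₗ_)
open import Relation.Binary.PropositionalEquality using (_≡_; _≢_)
open import Relation.Nullary using (¬_)

record SimplicialComplex (p : ℕ) : Set where
  field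
    simplices  : List (Subset p)
    unique     : Unique simplices
    nonempty   : All Nonempty simplices
    singletons : ∀ (x : Fin p) → ⁅ x ⁆ ∈ₗ simplices
    closed     : ∀ {σ τ : Subset p} → σ ∈ₗ simplices → τ ⊆ σ → Nonempty τ → τ ∈ₗ simplices
open SimplicialComplex public

IsSimplex : ∀ {p} → SimplicialComplex p → ℕ → Subset p → Set
IsSimplex K k σ = σ ∈ₗ simplices K × ∣ σ ∣ ≡ suc k

α : ∀ {p} → ℕ → SimplicialComplex p → ℕ
α k K = length (filter (λ s → ∣ s ∣ ≟ suc k) (simplices K))

HasDim : ∀ {p} → ℕ → SimplicialComplex p → Set
HasDim n K = (∃ λ σ → IsSimplex K n σ)
           × (∀ {σ} → σ ∈ₗ simplices K → ∣ σ ∣ ≤ suc n)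

IsPure : ∀ {p} → ℕ → SimplicialComplex p → Set
IsPure n K = HasDim n K
           × (∀ {σ} → σ ∈ₗ simplices K → ∃ λ η → IsSimplex K n η × σ ⊆ η)

-- Sequences are indexed 1-based by ℕ: σ 1, η 1, σ 2, …, η r, σ (r+1);
-- values outside the index ranges are irrelevant.
Walk : ∀ {p} → ℕ → ℕ → SimplicialComplex p → (r : ℕ) → (ℕ → Subset p) → (ℕ → Subset p) → Set
Walk m n K r σ η =
    (∀ k → 1 ≤ k → k ≤ suc r → IsSimplex K m (σ k))
  × (∀ k → 1 ≤ k → k ≤ r → IsSimplex K n (η k))
  × (∀ k → 1 ≤ k → k ≤ r → σ k ≢ σ (suc k) × σ k ⊆ η k × σ (suc k) ⊆ η k)

-- all simplices distinct (σ's and η's have different dimensions since m < n)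
PathSeq : ∀ {p} → ℕ → ℕ → SimplicialComplex p → (r : ℕ) → (ℕ → Subset p) → (ℕ → Subset p) → Set
PathSeq m n K r σ η =
    Walk m n K r σ η
  × (∀ i j → 1 ≤ i → i ≤ suc r → 1 ≤ j → j ≤ suc r → i ≢ j → σ i ≢ σ j)
  × (∀ i j → 1 ≤ i → i ≤ r → 1 ≤ j → j ≤ r → i ≢ j → η i ≢ η j)

Connected : ∀ {p} → ℕ → SimplicialComplex p → Set
Connected n K =
  ∀ τ τ' → IsSimplex K (n ∸ 1) τ → IsSimplex K (n ∸ 1) τ' → τ ≢ τ' →
  ∃ λ r → ∃ λ σ → ∃ λ η →
    PathSeq (n ∸ 1) n K r σ η × σ 1 ≡ τ × σ (suc r) ≡ τ'

CycleSeq : {p : ℕ} → ℕ → ℕ → SimplicialComplex p → (r : ℕ) → (ℕ → Subset p) → (ℕ → Subset p) → Set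
CycleSeq {p} m n K r σ η =
    Walk m n K r σ η
  × σ (suc r) ≡ σ 1
  × (∀ i j → 1 ≤ i → i ≤ r → 1 ≤ j → j ≤ r → i ≢ j → σ i ≢ σ j)
  × (∀ i j → 1 ≤ i → i ≤ r → 1 ≤ j → j ≤ r → i ≢ j → η i ≢ η j)
  × 3 ≤ r
  × (∀ k → 2 ≤ k → k ≤ r ∸ 1 → ¬ (σ 1 ⊆ η k))
  × (∃ λ (σ' : ℕ → Subset p) →
        (∀ z → 2 ≤ z → z ≤ r →
             IsSimplex K (n ∸ 1) (σ' z) × σ' z ⊆ η (z ∸ 1) × σ' z ⊆ η z × σ z ⊆ σ' z)
      × (∀ z w → 2 ≤ z → z ≤ r → 2 ≤ w → w ≤ r → z ≢ w → σ' z ≢ σ' w))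

NoCycles : ∀ {p} → ℕ → ℕ → SimplicialComplex p → Set
NoCycles m n K = ∀ r σ η → ¬ CycleSeq m n K r σ η

Acyclic : ∀ {p} → ℕ → SimplicialComplex p → Set
Acyclic n K = ∀ m → m < n → NoCycles m n K

IsSimplicialTree : ∀ {p} → ℕ → SimplicialComplex p → Set
IsSimplicialTree n K = IsPure n K × Connected n K × Acyclic n K

{-# OPTIONS --safe #-}

-- Call two n-simplices adjacent when they share an (n - 1)-face, and grow a set P of n-simplices by
-- attaching adjacent ones along a facet f. Any two facets in P are joined by a path inside P.
--
-- Along a chain of distinct n-simplices with distinct links, absence of (m,n)-cycles forces every
-- m-simplex to occupy an interval: in a shortest violation, m-faces of the links that are new to
-- the chain are pairwise distinct and close up to an (m,n)-cycle. Applied to the new simplex η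
-- followed by a path in P, this says that an m-face of η already in P lies in f. So each step adds
-- exactly n facets, whatever m is, and for m = 0 exactly one vertex.
--
-- A tree is grown from any of its n-simplices, which gives both counts. Conversely, c components
-- have (number of n-simplices) * n + c facets, so c = 1 and K is grown; the vertex count then says
-- that every step adds a new vertex, which excludes cycles for all m.
module Submission where

open import Defs
open import Data.Nat using (ℕ; _+_; _*_; _∸_; _≤_; _<_)
open import Data.Product using (∃; _×_)
open import Relation.Binary.PropositionalEquality using (_≡_)

import Data.Bool as Bool
open import Data.Bool using (true; false)
open import Data.Fin using (Fin; zero; suc)
open import Data.Fin.Subset
  using (Subset; _∈_; _∉_; _⊆_; _⊈_; ∣_∣; ⁅_⁆; Nonempty; _∩_; _∪_; ⋃)
open import Data.Fin.Subset.Properties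
open import Data.List using (List; []; _∷_; [_]; _++_; length; filter; map)
open import Data.List.Membership.Propositional
  using (find; lose) renaming (_∈_ to _∈ₗ_; _∉_ to _∉ₗ_)
open import Data.List.Membership.Propositional.Properties
  using (∈-∃++; ∈-++⁺ˡ; ∈-++⁺ʳ; ∈-++⁻; ∈-map⁺; ∈-map⁻; ∈-filter⁺; ∈-filter⁻; ∈-length)
open import Data.List.Properties using (length-map; length-++; ++-assoc)
open import Data.List.Relation.Binary.Permutation.Propositional
  using (_↭_; ↭-refl; ↭-sym; ↭-trans; ↭-reflexive; prep; ↭⇒↭ₛ)
open import Data.List.Relation.Binary.Permutation.Propositional.Properties
  using (↭-length; shift; ∈-resp-↭)
open import Data.List.Relation.Binary.Permutation.Setoid.Properties using (Unique-resp-↭)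
open import Data.List.Relation.Binary.Subset.Propositional.Properties using (Any-resp-⊆)
open import Data.List.Relation.Unary.All as All using ([]; _∷_)
open import Data.List.Relation.Unary.AllPairs using ([]; _∷_)
open import Data.List.Relation.Unary.Any as Any using (Any; here; there; any?)
open import Data.List.Relation.Unary.Unique.Propositional using (Unique)
import Data.List.Relation.Unary.Unique.Propositional.Properties as Unique
open import Data.Nat using (zero; suc; pred; _≟_; _≤?_; _<?_; z≤n; s≤s)
open import Data.Nat.Induction using (<-rec)
open import Data.Nat.Properties
open import Data.Product using (_,_; proj₁; proj₂)
open import Data.Sum using (inj₁; inj₂; [_,_]′)
open import Data.Vec using ([]; _∷_; here; there)
import Data.Vec.Properties as Vec
open import Function using (_∘_; id)
open import Relation.Binary using (tri<; tri≈; tri>)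
open import Relation.Binary.PropositionalEquality
  using (_≢_; refl; sym; trans; cong; cong₂; subst; subst₂; setoid)
open import Relation.Nullary using (¬_; Dec; yes; no; contradiction)
open import Relation.Nullary.Decidable using (decidable-stable; ¬?)

-- Finite lists and finite sets

Unique-⊆⇒length≤ : ∀ {A : Set} {xs ys : List A} → Unique xs →
  (∀ {x} → x ∈ₗ xs → x ∈ₗ ys) → length xs ≤ length ys
Unique-⊆⇒length≤ [] _ = z≤n
Unique-⊆⇒length≤ {xs = x ∷ xs} (x∉ ∷ u) xs⊆ys with ∈-∃++ (xs⊆ys (here refl))
... | as , bs , refl =
  subst (suc (length xs) ≤_) (sym (↭-length (shift x as bs))) (s≤s (Unique-⊆⇒length≤ u sub))
  where
  sub : ∀ {y} → y ∈ₗ xs → y ∈ₗ as ++ bs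
  sub y∈ with ∈-resp-↭ (shift x as bs) (xs⊆ys (there y∈))
  ... | here refl = contradiction refl (All.lookup x∉ y∈)
  ... | there y∈' = y∈'

Unique-⊆⊇⇒length≡ : ∀ {A : Set} {xs ys : List A} → Unique xs → Unique ys →
  (∀ {x} → x ∈ₗ xs → x ∈ₗ ys) → (∀ {x} → x ∈ₗ ys → x ∈ₗ xs) → length xs ≡ length ys
Unique-⊆⊇⇒length≡ u v xs⊆ys ys⊆xs =
  ≤-antisym (Unique-⊆⇒length≤ u xs⊆ys) (Unique-⊆⇒length≤ v ys⊆xs)

infix 4 _≟ˢ_
_≟ˢ_ : ∀ {p} (A B : Subset p) → Dec (A ≡ B)
_≟ˢ_ = Vec.≡-dec Bool._≟_

⊈⇒∃∉ : ∀ {p} {A B : Subset p} → A ⊈ B → ∃ λ x → x ∈ A × x ∉ B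
⊈⇒∃∉ {A = []} {[]} A⊈B = contradiction (λ ()) A⊈B
⊈⇒∃∉ {A = false ∷ A} {b ∷ B} A⊈B with ⊈⇒∃∉ (A⊈B ∘ out⊆)
... | x , x∈ , x∉ = suc x , there x∈ , x∉ ∘ drop-there
⊈⇒∃∉ {A = true ∷ A} {false ∷ B} A⊈B = zero , here , λ ()
⊈⇒∃∉ {A = true ∷ A} {true ∷ B} A⊈B with ⊈⇒∃∉ (A⊈B ∘ in⊆in)
... | x , x∈ , x∉ = suc x , there x∈ , x∉ ∘ drop-there

⊆∧∣≤∣⇒≡ : ∀ {p} {A B : Subset p} → A ⊆ B → ∣ B ∣ ≤ ∣ A ∣ → A ≡ B
⊆∧∣≤∣⇒≡ {A = A} {B} A⊆B ∣B∣≤∣A∣ = ⊆-antisym A⊆B (decidable-stable (B ⊆? A)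
  λ B⊈A → <⇒≱ (p⊂q⇒∣p∣<∣q∣ (A⊆B , ⊈⇒∃∉ B⊈A)) ∣B∣≤∣A∣)

∣∪∣+∣∩∣ : ∀ {p} (A B : Subset p) → ∣ A ∪ B ∣ + ∣ A ∩ B ∣ ≡ ∣ A ∣ + ∣ B ∣
∣∪∣+∣∩∣ [] [] = refl
∣∪∣+∣∩∣ (false ∷ A) (false ∷ B) = ∣∪∣+∣∩∣ A B
∣∪∣+∣∩∣ (false ∷ A) (true ∷ B) = trans (cong suc (∣∪∣+∣∩∣ A B)) (sym (+-suc _ _))
∣∪∣+∣∩∣ (true ∷ A) (false ∷ B) = cong suc (∣∪∣+∣∩∣ A B)
∣∪∣+∣∩∣ (true ∷ A) (true ∷ B) =
  cong suc (trans (+-suc _ _) (trans (cong suc (∣∪∣+∣∩∣ A B)) (sym (+-suc _ _))))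

interpolate : ∀ {p} {A B : Subset p} k → A ⊆ B → ∣ A ∣ ≤ k → k ≤ ∣ B ∣ →
  ∃ λ C → A ⊆ C × C ⊆ B × ∣ C ∣ ≡ k
interpolate {A = []} {[]} zero _ _ _ = [] , id , id , refl
interpolate {A = false ∷ A} {false ∷ B} k A⊆B lo hi
  with interpolate k (drop-∷-⊆ A⊆B) lo hi
... | C , A⊆C , C⊆B , eq = false ∷ C , out⊆ A⊆C , out⊆ C⊆B , eq
interpolate {A = true ∷ A} {false ∷ B} k A⊆B lo hi with () ← A⊆B here
interpolate {A = true ∷ A} {true ∷ B} (suc k) A⊆B (s≤s lo) (s≤s hi)
  with interpolate k (drop-∷-⊆ A⊆B) lo hi
... | C , A⊆C , C⊆B , eq = true ∷ C , in⊆in A⊆C , in⊆in C⊆B , cong suc eq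
interpolate {A = false ∷ A} {true ∷ B} k A⊆B lo hi with k ≤? ∣ B ∣
... | yes k≤ with interpolate k (drop-∷-⊆ A⊆B) lo k≤
...   | C , A⊆C , C⊆B , eq = false ∷ C , out⊆ A⊆C , out⊆ C⊆B , eq
interpolate {A = false ∷ A} {true ∷ B} k A⊆B lo hi | no k≰ =
  true ∷ B , out⊆ (drop-∷-⊆ A⊆B) , id , ≤-antisym (≰⇒> k≰) hi

subset-through : ∀ {p} {B : Subset p} {x} k → x ∈ B → 1 ≤ k → k ≤ ∣ B ∣ →
  ∃ λ C → x ∈ C × C ⊆ B × ∣ C ∣ ≡ k
subset-through {B = B} {x} k x∈B 1≤k k≤∣B∣
  with interpolate {A = ⁅ x ⁆} k (λ y∈ → subst (_∈ B) (sym (x∈⁅y⁆⇒x≡y x y∈)) x∈B)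
         (subst (_≤ k) (sym (∣⁅x⁆∣≡1 x)) 1≤k) k≤∣B∣
... | C , x∈C , C⊆B , eq = C , x∈C (x∈⁅x⁆ x) , C⊆B , eq

-- Two distinct sets of size `k + 1` meet in at most `k` elements, which `f` already fills. So two
-- adjacent n-simplices determine their common facet.
facet-unique : ∀ {p k} {f A B : Subset p} → A ≢ B → ∣ A ∣ ≡ suc k → ∣ B ∣ ≡ suc k →
  ∣ f ∣ ≡ k → f ⊆ A → f ⊆ B → f ≡ A ∩ B
facet-unique {k = k} {f} {A} {B} A≢B ∣A∣ ∣B∣ ∣f∣ f⊆A f⊆B =
  ⊆∧∣≤∣⇒≡ (λ x∈ → x∈p∩q⁺ (f⊆A x∈ , f⊆B x∈)) (subst (∣ A ∩ B ∣ ≤_) (sym ∣f∣) (≮⇒≥ k≮))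
  where
  k≮ : ¬ k < ∣ A ∩ B ∣
  k≮ k< = A≢B (trans
    (sym (⊆∧∣≤∣⇒≡ (p∩q⊆p A B) (subst (_≤ ∣ A ∩ B ∣) (sym ∣A∣) k<)))
    (⊆∧∣≤∣⇒≡ (p∩q⊆q A B) (subst (_≤ ∣ A ∩ B ∣) (sym ∣B∣) k<)))

∈⇒⊆⋃ : ∀ {p} {A : Subset p} {P} → A ∈ₗ P → A ⊆ ⋃ P
∈⇒⊆⋃ {P = B ∷ P} (here refl) = p⊆p∪q (⋃ P)
∈⇒⊆⋃ {P = B ∷ P} (there A∈) = q⊆p∪q B (⋃ P) ∘ ∈⇒⊆⋃ A∈

x∈⋃⁻ : ∀ {p} {x : Fin p} P → x ∈ ⋃ P → ∃ λ A → A ∈ₗ P × x ∈ A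
x∈⋃⁻ [] x∈ = contradiction x∈ ∉⊥
x∈⋃⁻ (B ∷ P) x∈ with x∈p∪q⁻ B (⋃ P) x∈
... | inj₁ x∈B = B , here refl , x∈B
... | inj₂ x∈P with x∈⋃⁻ P x∈P
...   | A , A∈ , x∈A = A , there A∈ , x∈A

-- The facets of a finite set

facets : ∀ {p} → Subset p → List (Subset p)
facets [] = []
facets (false ∷ A) = map (false ∷_) (facets A)
facets (true ∷ A) = (false ∷ A) ∷ map (true ∷_) (facets A)

length-facets : ∀ {p} (A : Subset p) → length (facets A) ≡ ∣ A ∣
length-facets [] = refl
length-facets (false ∷ A) = trans (length-map _ (facets A)) (length-facets A)
length-facets (true ∷ A) = cong suc (trans (length-map _ (facets A)) (length-facets A))

facets-unique : ∀ {p} (A : Subset p) → Unique (facets A)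
facets-unique [] = []
facets-unique (false ∷ A) = Unique.map⁺ Vec.∷-injectiveʳ (facets-unique A)
facets-unique (true ∷ A) =
  All.tabulate (λ B∈ eq → contradiction (trans eq (proj₂ (proj₂ (∈-map⁻ _ B∈)))) λ ())
  ∷ Unique.map⁺ Vec.∷-injectiveʳ (facets-unique A)

∈-facets⁻ : ∀ {p} {f : Subset p} A → f ∈ₗ facets A → f ⊆ A × suc ∣ f ∣ ≡ ∣ A ∣
∈-facets⁻ (false ∷ A) f∈ with ∈-map⁻ _ f∈
... | g , g∈ , refl with ∈-facets⁻ A g∈
...   | g⊆A , eq = out⊆ g⊆A , eq
∈-facets⁻ (true ∷ A) (here refl) = out⊆ id , refl
∈-facets⁻ (true ∷ A) (there f∈) with ∈-map⁻ _ f∈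
... | g , g∈ , refl with ∈-facets⁻ A g∈
...   | g⊆A , eq = in⊆in g⊆A , cong suc eq

∈-facets⁺ : ∀ {p} {f A : Subset p} → f ⊆ A → suc ∣ f ∣ ≡ ∣ A ∣ → f ∈ₗ facets A
∈-facets⁺ {f = false ∷ f} {false ∷ A} f⊆A eq = ∈-map⁺ _ (∈-facets⁺ (drop-∷-⊆ f⊆A) eq)
∈-facets⁺ {f = false ∷ f} {true ∷ A} f⊆A eq =
  here (cong (false ∷_) (⊆∧∣≤∣⇒≡ (drop-∷-⊆ f⊆A) (≤-reflexive (sym (suc-injective eq)))))
∈-facets⁺ {f = true ∷ f} {false ∷ A} f⊆A eq with () ← f⊆A here
∈-facets⁺ {f = true ∷ f} {true ∷ A} f⊆A eq =
  there (∈-map⁺ _ (∈-facets⁺ (drop-∷-⊆ f⊆A) (suc-injective eq)))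

∣∣≡suc⇒Nonempty : ∀ {p k} {A : Subset p} → ∣ A ∣ ≡ suc k → Nonempty A
∣∣≡suc⇒Nonempty {p} {A = A} ∣A∣ with nonempty? A
... | yes ne = ne
... | no empty = contradiction
  (trans (sym ∣A∣) (trans (cong ∣_∣ (Empty-unique empty)) (∣⊥∣≡0 p))) λ ()

-- Chains of n-simplices and the interval property

⊆⇒IsSimplex : ∀ {p m n} (K : SimplicialComplex p) {σ τ : Subset p} → IsSimplex K n τ →
  σ ⊆ τ → ∣ σ ∣ ≡ suc m → IsSimplex K m σ
⊆⇒IsSimplex K (τ∈K , _) σ⊆τ ∣σ∣ = closed K τ∈K σ⊆τ (∣∣≡suc⇒Nonempty ∣σ∣) , ∣σ∣

injective : ∀ {A : Set} {g : ℕ → A} {a b} →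
  (∀ i j → a ≤ i → i < j → j ≤ b → g i ≢ g j) →
  ∀ i j → a ≤ i → i ≤ b → a ≤ j → j ≤ b → i ≢ j → g i ≢ g j
injective inj i j a≤i i≤b a≤j j≤b i≢j with <-cmp i j
... | tri< i<j _ _ = inj i j a≤i i<j j≤b
... | tri≈ _ i≡j _ = contradiction i≡j i≢j
... | tri> _ _ j<i = inj j i a≤j j<i i≤b ∘ sym

-- Unlike PathSeq, a chain starts and ends with a top-dimensional simplex and is indexed from 0.
-- Here and below the dimension n is suc d.
record Chain {p} (K : SimplicialComplex p) (d r : ℕ) (f θ : ℕ → Subset p) : Set where
  field
    simplex     : ∀ {k} → k ≤ r → IsSimplex K (suc d) (θ k)
    ∣link∣      : ∀ {k} → k < r → ∣ f k ∣ ≡ suc d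
    link⊆       : ∀ {k} → k < r → f k ⊆ θ k
    link⊆-suc   : ∀ {k} → k < r → f k ⊆ θ (suc k)
    simplex-inj : ∀ {i j} → i < j → j ≤ r → θ i ≢ θ j
    link-inj    : ∀ {i j} → i < j → j < r → f i ≢ f j

module _ {p} {K : SimplicialComplex p} {d : ℕ} where
  open Chain

  Chain-prefix : ∀ {r s f θ} → s ≤ r → Chain K d r f θ → Chain K d s f θ
  Chain-prefix s≤r C = record
    { simplex     = λ k≤ → C .simplex (≤-trans k≤ s≤r)
    ; ∣link∣      = λ k< → C .∣link∣ (<-≤-trans k< s≤r)
    ; link⊆       = λ k< → C .link⊆ (<-≤-trans k< s≤r)
    ; link⊆-suc   = λ k< → C .link⊆-suc (<-≤-trans k< s≤r)
    ; simplex-inj = λ i<j j≤ → C .simplex-inj i<j (≤-trans j≤ s≤r)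
    ; link-inj    = λ i<j j< → C .link-inj i<j (<-≤-trans j< s≤r)
    }

  Chain-suffix : ∀ {s f θ} a → Chain K d (a + s) f θ →
    Chain K d s (λ k → f (a + k)) (λ k → θ (a + k))
  Chain-suffix {s} {θ = θ} a C = record
    { simplex     = λ k≤ → C .simplex (+-monoʳ-≤ a k≤)
    ; ∣link∣      = λ k< → C .∣link∣ (+-monoʳ-< a k<)
    ; link⊆       = λ k< → C .link⊆ (+-monoʳ-< a k<)
    ; link⊆-suc   = λ {k} k< {x} x∈ →
        subst (λ z → x ∈ θ z) (sym (+-suc a k)) (C .link⊆-suc (+-monoʳ-< a k<) x∈)
    ; simplex-inj = λ i<j j≤ → C .simplex-inj (+-monoʳ-< a i<j) (+-monoʳ-≤ a j≤)
    ; link-inj    = λ i<j j< → C .link-inj (+-monoʳ-< a i<j) (+-monoʳ-< a j<)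
    }

  -- The interval property for chains of `r` steps. It quantifies over all chains because the
  -- induction on `r` passes to subchains re-indexed from 0.
  Convex : ℕ → ℕ → Set
  Convex m r = ∀ {f θ} → Chain K d r f θ → ∀ {ρ} → ∣ ρ ∣ ≡ suc m → ρ ⊆ θ 0 → ρ ⊆ θ r →
    ∀ k → k ≤ r → ρ ⊆ θ k

  -- Otherwise both links `f k` and `f (suc k)` would be the intersection of `θ k` and `θ (suc k)`,
  -- against `link-inj`.
  link-turns : ∀ {r f θ} → Chain K d r f θ → ∀ {k} → suc k < r → f (suc k) ⊈ θ k
  link-turns {f = f} {θ} C {k} k+1<r f⊆θ =
    C .link-inj (n<1+n k) k+1<r (trans
      (meet (C .∣link∣ k<r) (C .link⊆ k<r) (C .link⊆-suc k<r))
      (sym (meet (C .∣link∣ k+1<r) f⊆θ (C .link⊆ k+1<r))))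
    where
    k<r = <-trans (n<1+n k) k+1<r
    meet : ∀ {g} → ∣ g ∣ ≡ suc d → g ⊆ θ k → g ⊆ θ (suc k) → g ≡ θ k ∩ θ (suc k)
    meet = facet-unique (C .simplex-inj (n<1+n k) (<⇒≤ k+1<r))
      (proj₂ (C .simplex (<⇒≤ k<r))) (proj₂ (C .simplex k<r))

  -- By convexity, a face of the k-th link not contained in θ (k - 1) lies in no earlier link.
  link-faces : ∀ {m r f θ} → m ≤ d → Chain K d r f θ → ∀ k → k < r →
    ∃ λ τ → ∣ τ ∣ ≡ suc m × τ ⊆ f k × (∀ {l} → k ≡ suc l → τ ⊈ θ l)
  link-faces {m} {r} {f} {θ} m≤d C = go
    where
    face-through : ∀ k {x} → k < r → x ∈ f k → ∃ λ τ → x ∈ τ × τ ⊆ f k × ∣ τ ∣ ≡ suc m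
    face-through k k<r x∈ = subset-through (suc m) x∈ (s≤s z≤n)
      (subst (suc m ≤_) (sym (C .∣link∣ k<r)) (s≤s m≤d))
    go : ∀ k → k < r → ∃ λ τ → ∣ τ ∣ ≡ suc m × τ ⊆ f k × (∀ {l} → k ≡ suc l → τ ⊈ θ l)
    go zero k<r with face-through zero k<r (proj₂ (∣∣≡suc⇒Nonempty (C .∣link∣ k<r)))
    ... | τ , _ , τ⊆ , ∣τ∣ = τ , ∣τ∣ , τ⊆ , λ ()
    go (suc l) k<r with ⊈⇒∃∉ (link-turns C k<r)
    ... | x , x∈f , x∉θ with face-through (suc l) k<r x∈f
    ...   | τ , x∈τ , τ⊆ , ∣τ∣ = τ , ∣τ∣ , τ⊆ , λ { refl τ⊆θ → x∉θ (τ⊆θ x∈τ) }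

  -- A face `ρ` that leaves the chain after `θ 0` and returns only at `θ r` gives the cycle `ρ`,
  -- `θ 0`, `face 0`, `θ 1`, ..., `face (r - 1)`, `θ r`, `ρ`. Cycles are indexed from 1, so `face k`
  -- has index `k + 2` and `θ k` has index `k + 1`.
  module Return {m r f θ ρ} (m≤d : m ≤ d) (convex : ∀ {s} → s < r → Convex m s)
    (C : Chain K d r f θ) (∣ρ∣ : ∣ ρ ∣ ≡ suc m) (ρ⊆θ₀ : ρ ⊆ θ 0) (ρ⊆θᵣ : ρ ⊆ θ r)
    (2≤r : 2 ≤ r) (ρ⊈ : ∀ {k} → 0 < k → k < r → ρ ⊈ θ k) where

    -- The junk value from r on is ρ, so that the sequence σ of the cycle closes up.
    face : ℕ → Subset p
    face k with k <? r
    ... | yes k<r = proj₁ (link-faces m≤d C k k<r)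
    ... | no _ = ρ

    face-end : face r ≡ ρ
    face-end with r <? r
    ... | yes r<r = contradiction r<r (<-irrefl refl)
    ... | no _ = refl

    face-spec : ∀ k → k < r →
      ∣ face k ∣ ≡ suc m × face k ⊆ f k × (∀ {l} → k ≡ suc l → face k ⊈ θ l)
    face-spec k k<r with k <? r
    ... | yes k<r' = proj₂ (link-faces m≤d C k k<r')
    ... | no k≮r = contradiction k<r k≮r

    face⊆ : ∀ {k} → k < r → face k ⊆ θ k
    face⊆ k<r = C .link⊆ k<r ∘ proj₁ (proj₂ (face-spec _ k<r))

    face⊆-suc : ∀ {k} → k < r → face k ⊆ θ (suc k)
    face⊆-suc k<r = C .link⊆-suc k<r ∘ proj₁ (proj₂ (face-spec _ k<r))

    -- A repeated face lies in `θ i` and in `θ (suc j)`, hence by convexity of the shorter chain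
    -- between them in `θ j`, which the choice of `face (suc j)` excludes.
    face-inj : ∀ {i j} → i < j → j < r → face i ≢ face j
    face-inj {i} {suc j} (s≤s i≤j) j+1<r eq with m≤n⇒∃[o]m+o≡n i≤j
    ... | e , refl =
      proj₂ (proj₂ (face-spec _ j+1<r)) refl
        (subst (_⊆ θ (i + e)) eq
          (convex (≤-<-trans (s≤s (m≤n+m e i)) j+1<r)
            (Chain-suffix i (Chain-prefix (≤-trans (≤-reflexive (+-suc i e)) (<⇒≤ j+1<r)) C))
            (proj₁ (face-spec i i<r))
            (subst (λ k → face i ⊆ θ k) (sym (+-identityʳ i)) (face⊆ i<r))
            (subst₂ (λ A k → A ⊆ θ k) (sym eq) (sym (+-suc i e)) (face⊆ j+1<r))
            e (n≤1+n e)))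
      where
      i<r : i < r
      i<r = ≤-<-trans (m≤n⇒m≤1+n (m≤m+n i e)) j+1<r

    -- Every `face k` lies in an interior simplex, where `ρ` does not: in `θ k` if `k` is positive,
    -- and in `θ 1` if `k` is 0, which is interior as `2 ≤ r`.
    ρ≢face : ∀ {k} → k < r → ρ ≢ face k
    ρ≢face {zero} k<r eq = ρ⊈ (s≤s z≤n) 2≤r (subst (_⊆ θ 1) (sym eq) (face⊆-suc k<r))
    ρ≢face {suc k} k<r eq = ρ⊈ (s≤s z≤n) k<r (subst (_⊆ θ (suc k)) (sym eq) (face⊆ k<r))

    σ : ℕ → Subset p
    σ zero = ρ
    σ (suc zero) = ρ
    σ (suc (suc k)) = face k

    σ-simplex : ∀ k → 1 ≤ k → k ≤ suc (suc r) → IsSimplex K m (σ k)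
    σ-simplex (suc zero) _ _ = ⊆⇒IsSimplex K (C .simplex z≤n) ρ⊆θ₀ ∣ρ∣
    σ-simplex (suc (suc k)) _ (s≤s (s≤s k≤r)) with m≤n⇒m<n∨m≡n k≤r
    ... | inj₁ k<r = ⊆⇒IsSimplex K (C .simplex k≤r) (face⊆ k<r) (proj₁ (face-spec k k<r))
    ... | inj₂ refl = subst (IsSimplex K m) (sym face-end) (σ-simplex 1 ≤-refl (s≤s z≤n))

    σ-inj< : ∀ i j → 1 ≤ i → i < j → j ≤ suc r → σ i ≢ σ j
    σ-inj< (suc zero) (suc (suc j)) _ _ (s≤s j<r) = ρ≢face j<r
    σ-inj< (suc (suc i)) (suc (suc j)) _ (s≤s (s≤s i<j)) (s≤s j<r) = face-inj i<j j<r
    σ-inj< (suc zero) (suc zero) _ (s≤s ()) _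

    σ⊆ : ∀ k → 1 ≤ k → k ≤ suc r → σ k ⊆ θ (pred k)
    σ⊆ (suc zero) _ _ = ρ⊆θ₀
    σ⊆ (suc (suc k)) _ (s≤s k<r) = face⊆-suc k<r

    σ-suc⊆ : ∀ k → 1 ≤ k → k ≤ suc r → σ (suc k) ⊆ θ (pred k)
    σ-suc⊆ (suc k) _ (s≤s k≤r) with m≤n⇒m<n∨m≡n k≤r
    ... | inj₁ k<r = face⊆ k<r
    ... | inj₂ refl = subst (_⊆ θ k) (sym face-end) ρ⊆θᵣ

    σ-step : ∀ k → 1 ≤ k → k ≤ suc r → σ k ≢ σ (suc k)
    σ-step k 1≤k k≤ with m≤n⇒m<n∨m≡n k≤
    ... | inj₁ k<r = σ-inj< k (suc k) 1≤k ≤-refl k<r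
    σ-step (suc (suc k)) 1≤k k≤ | inj₂ refl = λ eq →
      ρ≢face ≤-refl (trans (sym face-end) (sym eq))
    σ-step (suc zero) 1≤k k≤ | inj₂ refl = contradiction 2≤r λ ()

    cycle : CycleSeq m (suc d) K (suc r) σ (θ ∘ pred)
    cycle = ( σ-simplex
            , (λ k _ k≤ → C .simplex (pred-mono-≤ k≤))
            , (λ k 1≤k k≤ → σ-step k 1≤k k≤ , σ⊆ k 1≤k k≤ , σ-suc⊆ k 1≤k k≤))
          , face-end
          , injective σ-inj<
          , injective (λ { (suc i) (suc j) _ (s≤s i<j) (s≤s j≤r) → C .simplex-inj i<j j≤r })
          , s≤s 2≤r
          , (λ { (suc (suc k)) _ k<r → ρ⊈ (s≤s z≤n) k<r ; (suc zero) (s≤s ()) _ })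
          -- The facet required at position `z` is the link `f (z - 2)` between `θ (z - 2)` and
          -- `θ (z - 1)`.
          , f ∘ pred ∘ pred
          , (λ { (suc (suc k)) _ (s≤s k<r) →
                   ⊆⇒IsSimplex K (C .simplex (<⇒≤ k<r)) (C .link⊆ k<r) (C .∣link∣ k<r)
                 , C .link⊆ k<r , C .link⊆-suc k<r , proj₁ (proj₂ (face-spec k k<r))
               ; (suc zero) (s≤s ()) _ })
          , injective (λ { (suc (suc z)) (suc (suc w)) _ (s≤s (s≤s z<w)) (s≤s w<r) →
                             C .link-inj z<w w<r
                         ; (suc zero) _ (s≤s ()) _ _
                         ; (suc (suc _)) (suc zero) _ (s≤s ()) _ })

  -- Strong induction on `r`. If `ρ` misses `θ k` but lies in an interior `θ l`, one of the two
  -- shorter chains between `θ l` and the ends passes through `θ k` and contradicts the induction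
  -- hypothesis. So `ρ` misses the whole interior, and `Return` yields a cycle.
  NoCycles⇒Convex : ∀ {m} → m ≤ d → NoCycles m (suc d) K → ∀ r → Convex m r
  NoCycles⇒Convex {m} m≤d acyclic = <-rec (Convex m) go
    where
    go : ∀ r → (∀ {s} → s < r → Convex m s) → Convex m r
    go r convex {f} {θ} C {ρ} ∣ρ∣ ρ⊆θ₀ ρ⊆θᵣ k k≤r = decidable-stable (ρ ⊆? θ k) λ ρ⊈θₖ →
      acyclic _ _ _ (Return.cycle m≤d convex C ∣ρ∣ ρ⊆θ₀ ρ⊆θᵣ
        (≤-trans (s≤s (0<k ρ⊈θₖ)) (k<r ρ⊈θₖ)) (outside-interior ρ⊈θₖ))
      where
      0<k : ρ ⊈ θ k → 0 < k
      0<k ρ⊈ = n≢0⇒n>0 λ { refl → ρ⊈ ρ⊆θ₀ }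
      k<r : ρ ⊈ θ k → k < r
      k<r ρ⊈ = ≤∧≢⇒< k≤r λ { refl → ρ⊈ ρ⊆θᵣ }
      outside-interior : ρ ⊈ θ k → ∀ {l} → 0 < l → l < r → ρ ⊈ θ l
      outside-interior ρ⊈ {l} 0<l l<r ρ⊆θₗ with ≤-total k l
      ... | inj₁ k≤l = ρ⊈ (convex l<r (Chain-prefix (<⇒≤ l<r) C) ∣ρ∣ ρ⊆θ₀ ρ⊆θₗ k k≤l)
      ... | inj₂ l≤k with m≤n⇒∃[o]m+o≡n l≤k | m≤n⇒∃[o]m+o≡n (<⇒≤ l<r)
      ...   | e , refl | s , refl =
        ρ⊈ (convex (m<n+m s 0<l) (Chain-suffix l C) ∣ρ∣
          (subst (λ i → ρ ⊆ θ i) (sym (+-identityʳ l)) ρ⊆θₗ) ρ⊆θᵣ e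
          (+-cancelˡ-≤ l e s k≤r))

-- Growing a set of n-simplices, and paths inside it

infix 4 _⊆ₛ_ _⊆ₛ?_
_⊆ₛ_ : ∀ {p} → Subset p → List (Subset p) → Set
A ⊆ₛ P = Any (A ⊆_) P

_⊆ₛ?_ : ∀ {p} (A : Subset p) (P : List (Subset p)) → Dec (A ⊆ₛ P)
A ⊆ₛ? P = any? (A ⊆?_) P

record Attaches {p} (K : SimplicialComplex p) (d : ℕ) (P : List (Subset p)) (η f : Subset p) :
  Set where
  field
    simplex : IsSimplex K (suc d) η
    fresh   : η ∉ₗ P
    ∣f∣     : ∣ f ∣ ≡ suc d
    f⊆η     : f ⊆ η
    f⊆P     : f ⊆ₛ P

-- The head of the list is the simplex attached last.
data Grown {p} (K : SimplicialComplex p) (d : ℕ) : List (Subset p) → Set where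
  base   : ∀ {η} → IsSimplex K (suc d) η → Grown K d [ η ]
  attach : ∀ {η f P} → Grown K d P → Attaches K d P η f → Grown K d (η ∷ P)

module _ {p} {K : SimplicialComplex p} {d : ℕ} where

  Grown⇒IsSimplex : ∀ {P} → Grown K d P → ∀ {θ} → θ ∈ₗ P → IsSimplex K (suc d) θ
  Grown⇒IsSimplex (base s) (here refl) = s
  Grown⇒IsSimplex (attach _ a) (here refl) = Attaches.simplex a
  Grown⇒IsSimplex (attach G _) (there θ∈) = Grown⇒IsSimplex G θ∈

  Grown-inhabited : ∀ {P} → Grown K d P → ∃ (_∈ₗ P)
  Grown-inhabited (base _) = _ , here refl
  Grown-inhabited (attach _ _) = _ , here refl

  -- A path sequence confined to `P`. Confinement is what lets a simplex outside `P` be put in front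
  -- of it, in `prepend` and in `old-faces`.
  record Path (P : List (Subset p)) (r : ℕ) (σ η : ℕ → Subset p) : Set where
    field
      σ-size : ∀ k → 1 ≤ k → k ≤ suc r → ∣ σ k ∣ ≡ suc d
      σ-in   : ∀ k → 1 ≤ k → k ≤ suc r → σ k ⊆ₛ P
      η-in   : ∀ k → 1 ≤ k → k ≤ r → η k ∈ₗ P
      left   : ∀ k → 1 ≤ k → k ≤ r → σ k ⊆ η k
      right  : ∀ k → 1 ≤ k → k ≤ r → σ (suc k) ⊆ η k
      σ-inj  : ∀ i j → 1 ≤ i → i < j → j ≤ suc r → σ i ≢ σ j
      η-inj  : ∀ i j → 1 ≤ i → i < j → j ≤ r → η i ≢ η j
  open Path

  Linked : List (Subset p) → Subset p → Subset p → Set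
  Linked P τ τ' = ∃ λ r → ∃ λ σ → ∃ λ η → Path P r σ η × σ 1 ≡ τ × σ (suc r) ≡ τ'

  Path⇒PathSeq : ∀ {P r σ η} → (∀ {θ} → θ ∈ₗ P → IsSimplex K (suc d) θ) →
    Path P r σ η → PathSeq d (suc d) K r σ η
  Path⇒PathSeq simplex path =
      ( (λ k 1≤k k≤ → let θ , θ∈P , σ⊆θ = find (path .σ-in k 1≤k k≤) in
           ⊆⇒IsSimplex K (simplex θ∈P) σ⊆θ (path .σ-size k 1≤k k≤))
      , (λ k 1≤k k≤ → simplex (path .η-in k 1≤k k≤))
      , λ k 1≤k k≤ → path .σ-inj k (suc k) 1≤k ≤-refl (s≤s k≤)
                   , path .left k 1≤k k≤ , path .right k 1≤k k≤)
    , injective (path .σ-inj)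
    , injective (path .η-inj)

  weaken : ∀ {η P τ τ'} → Linked P τ τ' → Linked (η ∷ P) τ τ'
  weaken (r , σ , η , path , start , end) = r , σ , η , record
    { σ-size = path .σ-size ; σ-in = λ k a b → there (path .σ-in k a b)
    ; η-in = λ k a b → there (path .η-in k a b) ; left = path .left ; right = path .right
    ; σ-inj = path .σ-inj ; η-inj = path .η-inj } , start , end

  step : ∀ {η P τ τ'} → η ∈ₗ P → ∣ τ ∣ ≡ suc d → ∣ τ' ∣ ≡ suc d → τ ⊆ η → τ' ⊆ η → τ ≢ τ' →
    Linked P τ τ'
  step {η} {P} {τ} {τ'} η∈P ∣τ∣ ∣τ'∣ τ⊆η τ'⊆η τ≢τ' = 1 , σ , (λ _ → η) , record
    { σ-size = λ { (suc zero) _ _ → ∣τ∣ ; (suc (suc _)) _ _ → ∣τ'∣ }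
    ; σ-in = λ { (suc zero) _ _ → lose η∈P τ⊆η ; (suc (suc _)) _ _ → lose η∈P τ'⊆η }
    ; η-in = λ _ _ _ → η∈P
    ; left = λ { (suc zero) _ _ → τ⊆η ; (suc (suc _)) _ (s≤s ()) }
    ; right = λ { (suc _) _ _ → τ'⊆η }
    ; σ-inj = λ { (suc zero) (suc (suc _)) _ _ _ → τ≢τ'
                ; (suc zero) (suc zero) _ (s≤s ()) _
                ; (suc (suc _)) (suc (suc zero)) _ (s≤s (s≤s ())) _
                ; (suc (suc _)) (suc (suc (suc _))) _ _ (s≤s (s≤s ())) }
    ; η-inj = λ { (suc _) (suc (suc _)) _ _ (s≤s ()) ; (suc _) (suc zero) _ (s≤s ()) _ }
    } , refl , refl
    where
    σ : ℕ → Subset p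
    σ (suc zero) = τ
    σ _ = τ'

  -- The given path stays in `P`, while `η` is not in `P` and `τ` lies in no member of `P`, so
  -- nothing is repeated.
  prepend : ∀ {η f P τ τ'} → η ∉ₗ P → ∣ τ ∣ ≡ suc d → τ ⊆ η → ¬ τ ⊆ₛ P → f ⊆ η →
    Linked P f τ' → Linked (η ∷ P) τ τ'
  prepend {η₀} {f} {P} {τ} {τ'} η∉P ∣τ∣ τ⊆η τ⊈P f⊆η (r , σ , η , path , refl , refl) =
    suc r , σ⁺ , η⁺ , record
    { σ-size = λ { (suc zero) _ _ → ∣τ∣
                 ; (suc (suc k)) _ (s≤s k≤) → path .σ-size (suc k) (s≤s z≤n) k≤ }
    ; σ-in = λ { (suc zero) _ _ → here τ⊆η
               ; (suc (suc k)) _ (s≤s k≤) → there (path .σ-in (suc k) (s≤s z≤n) k≤) }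
    ; η-in = λ { (suc zero) _ _ → here refl
               ; (suc (suc k)) _ (s≤s k≤) → there (path .η-in (suc k) (s≤s z≤n) k≤) }
    ; left = λ { (suc zero) _ _ → τ⊆η
               ; (suc (suc k)) _ (s≤s k≤) → path .left (suc k) (s≤s z≤n) k≤ }
    ; right = λ { (suc zero) _ _ → f⊆η
                ; (suc (suc k)) _ (s≤s k≤) → path .right (suc k) (s≤s z≤n) k≤ }
    ; σ-inj = λ { (suc zero) (suc zero) _ (s≤s ()) _
                ; (suc zero) (suc (suc j)) _ _ (s≤s j≤) eq →
                    τ⊈P (subst (_⊆ₛ P) (sym eq) (path .σ-in (suc j) (s≤s z≤n) j≤))
                ; (suc (suc i)) (suc (suc j)) _ (s≤s i<j) (s≤s j≤) →
                    path .σ-inj (suc i) (suc j) (s≤s z≤n) i<j j≤ }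
    ; η-inj = λ { (suc zero) (suc zero) _ (s≤s ()) _
                ; (suc zero) (suc (suc j)) _ _ (s≤s j≤) eq →
                    η∉P (subst (_∈ₗ P) (sym eq) (path .η-in (suc j) (s≤s z≤n) j≤))
                ; (suc (suc i)) (suc (suc j)) _ (s≤s i<j) (s≤s j≤) →
                    path .η-inj (suc i) (suc j) (s≤s z≤n) i<j j≤ }
    } , refl , refl
    where
    σ⁺ η⁺ : ℕ → Subset p
    σ⁺ (suc (suc k)) = σ (suc k)
    σ⁺ _ = τ
    η⁺ (suc (suc k)) = η (suc k)
    η⁺ _ = η₀

  reverse : ∀ {P τ τ'} → Linked P τ τ' → Linked P τ' τ
  reverse {P} (r , σ , η , path , refl , refl) =
    -- The `σ` have indices 1 to `r + 1` and the `η` have 1 to `r`, so the two reflections differ by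
    -- one.
    r , (λ k → σ (2 + r ∸ k)) , (λ k → η (suc r ∸ k)) , record
    { σ-size = λ { k@(suc k') _ k≤ → path .σ-size (2 + r ∸ k) (pos k≤) (m∸n≤m (suc r) k') }
    ; σ-in = λ { k@(suc k') _ k≤ → path .σ-in (2 + r ∸ k) (pos k≤) (m∸n≤m (suc r) k') }
    ; η-in = λ { k@(suc k') _ k≤ → path .η-in (suc r ∸ k) (pos k≤) (m∸n≤m r k') }
    ; left = λ { k@(suc k') _ k≤ →
        subst (λ i → σ i ⊆ η (suc r ∸ k)) (sym (+-∸-assoc 1 (m≤n⇒m≤1+n k≤)))
          (path .right (suc r ∸ k) (pos k≤) (m∸n≤m r k')) }
    ; right = λ { k@(suc k') _ k≤ → path .left (suc r ∸ k) (pos k≤) (m∸n≤m r k') }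
    ; σ-inj = λ { i@(suc i') j _ i<j j≤ eq → path .σ-inj (2 + r ∸ j) (2 + r ∸ i)
        (pos j≤) (∸-monoʳ-< i<j (m≤n⇒m≤1+n j≤)) (m∸n≤m (suc r) i') (sym eq) }
    ; η-inj = λ { i@(suc i') j _ i<j j≤ eq → path .η-inj (suc r ∸ j) (suc r ∸ i)
        (pos j≤) (∸-monoʳ-< i<j (m≤n⇒m≤1+n j≤)) (m∸n≤m r i') (sym eq) }
    } , refl , cong σ (m+n∸n≡m 1 (suc r))
    where
    pos : ∀ {k l} → k ≤ l → 0 < suc l ∸ k
    pos k≤l = m<n⇒0<n∸m (s≤s k≤l)

  -- The new facet `τ` lies in `η`, whose bridge to `P` is `f`. If the target is `f` itself, `η`
  -- alone links it to `τ`; otherwise `η` is put in front of a path from `f`.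
  link-new-old : ∀ {η f P τ τ'} → Attaches K d P η f → (f ≢ τ' → Linked P f τ') →
    ∣ τ ∣ ≡ suc d → τ ⊆ₛ (η ∷ P) → ¬ τ ⊆ₛ P → Linked (η ∷ P) τ τ'
  link-new-old {f = f} {τ' = τ'} a link ∣τ∣ τ⊆ τ⊈P with f ≟ˢ τ'
  ... | yes refl = step (here refl) ∣τ∣ ∣f∣ (Any.head τ⊈P τ⊆) f⊆η λ { refl → τ⊈P f⊆P }
    where open Attaches a
  ... | no f≢τ' = prepend fresh ∣τ∣ (Any.head τ⊈P τ⊆) τ⊈P f⊆η (link f≢τ')
    where open Attaches a

  -- Induction on the growth: two old facets are joined in `P`, two new ones through `η`, and an old
  -- and a new one across `f`.
  Grown⇒Linked : ∀ {P} → Grown K d P → ∀ {τ τ'} → ∣ τ ∣ ≡ suc d → ∣ τ' ∣ ≡ suc d →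
    τ ⊆ₛ P → τ' ⊆ₛ P → τ ≢ τ' → Linked P τ τ'
  Grown⇒Linked (base _) ∣τ∣ ∣τ'∣ (here τ⊆) (here τ'⊆) = step (here refl) ∣τ∣ ∣τ'∣ τ⊆ τ'⊆
  Grown⇒Linked {η ∷ P} (attach G a) {τ} {τ'} ∣τ∣ ∣τ'∣ τ⊆ τ'⊆ τ≢τ'
    with τ ⊆ₛ? P | τ' ⊆ₛ? P
  ... | yes τ⊆P | yes τ'⊆P = weaken (Grown⇒Linked G ∣τ∣ ∣τ'∣ τ⊆P τ'⊆P τ≢τ')
  ... | no τ⊈P | yes τ'⊆P =
    link-new-old a (Grown⇒Linked G (a .∣f∣) ∣τ'∣ (a .f⊆P) τ'⊆P) ∣τ∣ τ⊆ τ⊈P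
    where open Attaches
  ... | yes τ⊆P | no τ'⊈P =
    reverse (link-new-old a (Grown⇒Linked G (a .∣f∣) ∣τ∣ (a .f⊆P) τ⊆P) ∣τ'∣ τ'⊆ τ'⊈P)
    where open Attaches
  ... | no τ⊈P | no τ'⊈P =
    step (here refl) ∣τ∣ ∣τ'∣ (Any.head τ⊈P τ⊆) (Any.head τ'⊈P τ'⊆) τ≢τ'

-- Facets and vertices of a grown set

Unique-++⁻ʳ : ∀ {A : Set} (xs : List A) {ys} → Unique (xs ++ ys) → Unique ys
Unique-++⁻ʳ [] u = u
Unique-++⁻ʳ (_ ∷ xs) (_ ∷ u) = Unique-++⁻ʳ xs u

length-filter-≢ : ∀ {p} {f : Subset p} {L} → Unique L → f ∈ₗ L →
  suc (length (filter (λ g → ¬? (g ≟ˢ f)) L)) ≡ length L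
length-filter-≢ {f = f} {L} u f∈ = Unique-⊆⊇⇒length≡ (All.tabulate fresh ∷ Unique.filter⁺ _ u) u
  (λ { (here refl) → f∈ ; (there g∈) → proj₁ (∈-filter⁻ _ g∈) }) back
  where
  fresh : ∀ {g} → g ∈ₗ filter (λ g → ¬? (g ≟ˢ f)) L → f ≢ g
  fresh g∈ = proj₂ (∈-filter⁻ (λ g → ¬? (g ≟ˢ f)) {xs = L} g∈) ∘ sym
  back : ∀ {g} → g ∈ₗ L → g ∈ₗ f ∷ filter (λ g → ¬? (g ≟ˢ f)) L
  back {g} g∈ with g ≟ˢ f
  ... | yes refl = here refl
  ... | no g≢f = there (∈-filter⁺ _ g∈ g≢f)

-- Enough for lower bounds on the number of facets; `FacetsOf` adds completeness for exact counts.
record FacetsWithin {p} (d : ℕ) (P L : List (Subset p)) : Set where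
  field
    distinct : Unique L
    sound    : ∀ {g} → g ∈ₗ L → ∣ g ∣ ≡ suc d × g ⊆ₛ P

record FacetsOf {p} (d : ℕ) (P L : List (Subset p)) : Set where
  field
    within   : FacetsWithin d P L
    complete : ∀ {g} → ∣ g ∣ ≡ suc d → g ⊆ₛ P → g ∈ₗ L
  open FacetsWithin within public

FacetsWithin-mono : ∀ {p d} {P Q L : List (Subset p)} → (∀ {θ} → θ ∈ₗ P → θ ∈ₗ Q) →
  FacetsWithin d P L → FacetsWithin d Q L
FacetsWithin-mono P⊆Q F = record
  { distinct = distinct ; sound = λ g∈ → proj₁ (sound g∈) , Any-resp-⊆ P⊆Q (proj₂ (sound g∈)) }
  where open FacetsWithin F

module _ {p} {K : SimplicialComplex p} {d : ℕ} where
  open Attaches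

  -- A path in `P` from `f` to `g`, preceded by `η`, is a chain with `ρ` in both ends. Convexity
  -- puts `ρ` into `θ 1`, and `f` is the intersection of `η` and `θ 1`.
  old-faces : ∀ {m P η f ρ g} → m ≤ d → NoCycles m (suc d) K → Grown K d P → Attaches K d P η f →
    ρ ⊆ η → ∣ ρ ∣ ≡ suc m → ρ ⊆ g → ∣ g ∣ ≡ suc d → g ⊆ₛ P → ρ ⊆ f
  old-faces {P = P} {η} {f} {ρ} {g} m≤d acyclic G a ρ⊆η ∣ρ∣ ρ⊆g ∣g∣ g⊆P with f ≟ˢ g
  ... | yes refl = ρ⊆g
  ... | no f≢g with Grown⇒Linked G (a .∣f∣) ∣g∣ (a .f⊆P) g⊆P f≢g
  ...   | zero , _ , _ , _ , start , end = contradiction (trans (sym start) end) f≢g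
  ...   | suc r , σ , θ , path , refl , refl =
    subst (ρ ⊆_) (sym (facet-unique η≢θ₁ (proj₂ (a .simplex)) (proj₂ θ₁-simplex) (a .∣f∣)
                        (a .f⊆η) (path .left 1 ≤-refl (s≤s z≤n))))
      (λ x∈ → x∈p∩q⁺ (ρ⊆η x∈ , ρ⊆θ₁ x∈))
    where
    open Path
    θ⁺ : ℕ → Subset p
    θ⁺ zero = η
    θ⁺ (suc k) = θ (suc k)
    θ₁-simplex : IsSimplex K (suc d) (θ 1)
    θ₁-simplex = Grown⇒IsSimplex G (path .η-in 1 ≤-refl (s≤s z≤n))
    η≢θ : ∀ k → k < suc r → η ≢ θ (suc k)
    η≢θ k k<r eq = a .fresh (subst (_∈ₗ P) (sym eq) (path .η-in (suc k) (s≤s z≤n) k<r))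
    η≢θ₁ : η ≢ θ 1
    η≢θ₁ = η≢θ 0 (s≤s z≤n)
    -- Link `k` is `σ (suc k)`, beginning with `f` between `η` and `θ 1`. The endpoint `g` is not a
    -- link but lies in the last simplex.
    chain : Chain K d (suc r) (σ ∘ suc) θ⁺
    chain = record
      { simplex = λ { {zero} _ → a .simplex
                    ; {suc k} k≤ → Grown⇒IsSimplex G (path .η-in (suc k) (s≤s z≤n) k≤) }
      ; ∣link∣ = λ {k} k< → path .σ-size (suc k) (s≤s z≤n) (m≤n⇒m≤1+n k<)
      ; link⊆ = λ { {zero} _ → a .f⊆η ; {suc k} k< → path .right (suc k) (s≤s z≤n) (<⇒≤ k<) }
      ; link⊆-suc = λ {k} k< → path .left (suc k) (s≤s z≤n) k<
      ; simplex-inj = λ { {zero} {suc j} _ j≤ → η≢θ j j≤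
                        ; {suc i} {suc j} i<j j≤ → path .η-inj (suc i) (suc j) (s≤s z≤n) i<j j≤ }
      ; link-inj = λ {i} {j} i<j j< →
          path .σ-inj (suc i) (suc j) (s≤s z≤n) (s≤s i<j) (m≤n⇒m≤1+n j<)
      }
    ρ⊆θ₁ : ρ ⊆ θ 1
    ρ⊆θ₁ = NoCycles⇒Convex m≤d acyclic (suc r) chain ∣ρ∣ ρ⊆η
      (path .right (suc r) (s≤s z≤n) ≤-refl ∘ ρ⊆g) 1 (s≤s z≤n)

  -- Each vertex of `g` lies on some m-face of `g`, and `old-faces` puts that face into `f`. This
  -- makes the facet count the same for every `m`.
  old-facet : ∀ {m P η f g} → m ≤ d → NoCycles m (suc d) K → Grown K d P → Attaches K d P η f →
    ∣ g ∣ ≡ suc d → g ⊆ η → g ⊆ₛ P → g ≡ f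
  old-facet {m} {f = f} {g} m≤d acyclic G a ∣g∣ g⊆η g⊆P =
    ⊆∧∣≤∣⇒≡ g⊆f (≤-reflexive (trans (a .∣f∣) (sym ∣g∣)))
    where
    g⊆f : g ⊆ f
    g⊆f x∈g with subset-through (suc m) x∈g (s≤s z≤n) (subst (suc m ≤_) (sym ∣g∣) (s≤s m≤d))
    ... | ρ , x∈ρ , ρ⊆g , ∣ρ∣ = old-faces m≤d acyclic G a (g⊆η ∘ ρ⊆g) ∣ρ∣ ρ⊆g ∣g∣ g⊆P x∈ρ

  -- Case `m = 0` of `old-faces`. The facet asked for there is any facet through `x` of a member of
  -- `P`.
  old-vertices : ∀ {P η f} → NoCycles 0 (suc d) K → Grown K d P → Attaches K d P η f →
    η ∩ ⋃ P ⊆ f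
  old-vertices {P} {η} acyclic G a {x} x∈ with x∈p∩q⁻ η (⋃ P) x∈
  ... | x∈η , x∈U with x∈⋃⁻ P x∈U
  ...   | θ , θ∈P , x∈θ with subset-through (suc d) x∈θ (s≤s z≤n)
                         (≤-trans (n≤1+n _) (≤-reflexive (sym (proj₂ (Grown⇒IsSimplex G θ∈P)))))
  ...     | g , x∈g , g⊆θ , ∣g∣ =
    old-faces z≤n acyclic G a (⁅x⁆⊆ x∈η) (∣⁅x⁆∣≡1 x) (⁅x⁆⊆ x∈g) ∣g∣ (lose θ∈P g⊆θ) (x∈⁅x⁆ x)
    where
    ⁅x⁆⊆ : ∀ {A} → x ∈ A → ⁅ x ⁆ ⊆ A
    ⁅x⁆⊆ {A} x∈A y∈ = subst (_∈ A) (sym (x∈⁅y⁆⇒x≡y x y∈)) x∈A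

  -- An n-simplex has `d + 2` facets, and by `old-facet` only `f` is old, so each step adds `d + 1`.
  -- The first simplex contributes one more than that, hence the `suc`.
  facets-of-grown : ∀ {m P} → m ≤ d → NoCycles m (suc d) K → Grown K d P →
    ∃ λ L → FacetsOf d P L × length L ≡ suc (suc d * length P)
  facets-of-grown m≤d acyclic (base {η} (_ , ∣η∣)) = facets η , record
    { within = record
      { distinct = facets-unique η
      ; sound = λ g∈ → let g⊆η , eq = ∈-facets⁻ η g∈ in suc-injective (trans eq ∣η∣) , here g⊆η
      }
    ; complete = λ { ∣g∣ (here g⊆η) → ∈-facets⁺ g⊆η (trans (cong suc ∣g∣) (sym ∣η∣)) }
    } , trans (length-facets η) (trans ∣η∣ (cong suc (sym (*-identityʳ (suc d)))))
  facets-of-grown m≤d acyclic (attach {η} {f} {P} G a) with facets-of-grown m≤d acyclic G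
  ... | L , F , ∣L∣ = new ++ L , record
    { within = record
      { distinct = Unique.++⁺ (Unique.filter⁺ _ (facets-unique η)) (F .distinct) disjoint
      ; sound = λ g∈ → [ new-sound , (λ g∈L → let ∣g∣ , g⊆P = F .sound g∈L in ∣g∣ , there g⊆P) ]′
                         (∈-++⁻ new g∈)
      }
    ; complete = complete'
    } , trans (length-++ new) (trans (cong₂ _+_ ∣new∣ ∣L∣)
          (trans (+-suc (suc d) _) (cong suc (sym (*-suc (suc d) (length P))))))
    where
    open FacetsOf
    ∣η∣ : ∣ η ∣ ≡ suc (suc d)
    ∣η∣ = proj₂ (a .simplex)
    new : List (Subset p)
    new = filter (λ g → ¬? (g ≟ˢ f)) (facets η)
    new⁻ : ∀ {g} → g ∈ₗ new → (∣ g ∣ ≡ suc d × g ⊆ η) × g ≢ f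
    new⁻ g∈ with ∈-filter⁻ (λ g → ¬? (g ≟ˢ f)) {xs = facets η} g∈
    ... | g∈η , g≢f with ∈-facets⁻ η g∈η
    ...   | g⊆η , eq = (suc-injective (trans eq ∣η∣) , g⊆η) , g≢f
    new-sound : ∀ {g} → g ∈ₗ new → ∣ g ∣ ≡ suc d × g ⊆ₛ (η ∷ P)
    new-sound g∈ with new⁻ g∈
    ... | (∣g∣ , g⊆η) , _ = ∣g∣ , here g⊆η
    disjoint : ∀ {g} → ¬ (g ∈ₗ new × g ∈ₗ L)
    disjoint (g∈new , g∈L) with new⁻ g∈new
    ... | (∣g∣ , g⊆η) , g≢f = g≢f (old-facet m≤d acyclic G a ∣g∣ g⊆η (proj₂ (F .sound g∈L)))
    complete' : ∀ {g} → ∣ g ∣ ≡ suc d → g ⊆ₛ (η ∷ P) → g ∈ₗ new ++ L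
    complete' ∣g∣ (there g⊆P) = ∈-++⁺ʳ new (F .complete ∣g∣ g⊆P)
    complete' {g} ∣g∣ (here g⊆η) with g ≟ˢ f
    ... | yes refl = ∈-++⁺ʳ new (F .complete ∣g∣ (a .f⊆P))
    ... | no g≢f = ∈-++⁺ˡ (∈-filter⁺ _ (∈-facets⁺ g⊆η (trans (cong suc ∣g∣) (sym ∣η∣))) g≢f)
    ∣new∣ : length new ≡ suc d
    ∣new∣ = suc-injective (trans
      (length-filter-≢ (facets-unique η) (∈-facets⁺ (a .f⊆η) (trans (cong suc (a .∣f∣)) (sym ∣η∣))))
      (trans (length-facets η) ∣η∣))

  -- Inclusion-exclusion, arranged for comparing the overlap with `suc d`: the overlap has at least
  -- that size, with equality exactly when `η` brings one new vertex.
  attach-count : ∀ {P η f} → Attaches K d P η f →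
    ∣ η ∪ ⋃ P ∣ + ∣ η ∩ ⋃ P ∣ ≡ suc ∣ ⋃ P ∣ + suc d
  attach-count {P} {η} a = trans (∣∪∣+∣∩∣ η (⋃ P))
    (trans (cong (_+ ∣ ⋃ P ∣) (proj₂ (a .simplex))) (cong suc (+-comm (suc d) ∣ ⋃ P ∣)))

  f⊆η∩⋃ : ∀ {P η f} → Attaches K d P η f → f ⊆ η ∩ ⋃ P
  f⊆η∩⋃ a x∈f with find (a .f⊆P)
  ... | θ , θ∈P , f⊆θ = x∈p∩q⁺ (a .f⊆η x∈f , ∈⇒⊆⋃ θ∈P (f⊆θ x∈f))

  d<∣η∩⋃∣ : ∀ {P η f} → Attaches K d P η f → suc d ≤ ∣ η ∩ ⋃ P ∣
  d<∣η∩⋃∣ a = subst (_≤ _) (a .∣f∣) (p⊆q⇒∣p∣≤∣q∣ (f⊆η∩⋃ a))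

  ∣⋃[_]∣ : ∀ (η : Subset p) → ∣ ⋃ [ η ] ∣ ≡ ∣ η ∣
  ∣⋃[ η ]∣ = cong ∣_∣ (∪-identityʳ η)

  -- The `d + 1` vertices of `f` are old, so a step adds at most one vertex.
  ∣⋃grown∣≤ : ∀ {P} → Grown K d P → ∣ ⋃ P ∣ ≤ length P + suc d
  ∣⋃grown∣≤ (base {η} (_ , ∣η∣)) = ≤-reflexive (trans ∣⋃[ η ]∣ ∣η∣)
  ∣⋃grown∣≤ (attach {η} {f} {P} G a) = ≤-trans
    (+-cancelʳ-≤ (suc d) _ _
      (≤-trans (+-monoʳ-≤ ∣ η ∪ ⋃ P ∣ (d<∣η∩⋃∣ a)) (≤-reflexive (attach-count a))))
    (s≤s (∣⋃grown∣≤ G))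

  ∣⋃grown∣ : ∀ {P} → NoCycles 0 (suc d) K → Grown K d P → ∣ ⋃ P ∣ ≡ length P + suc d
  ∣⋃grown∣ acyclic (base {η} (_ , ∣η∣)) = trans ∣⋃[ η ]∣ ∣η∣
  ∣⋃grown∣ acyclic (attach {η} {f} {P} G a) = trans
    (+-cancelʳ-≡ (suc d) _ _ (trans
      (cong (∣ η ∪ ⋃ P ∣ +_) (sym (trans (cong ∣_∣ meet) (a .∣f∣)))) (attach-count a)))
    (cong suc (∣⋃grown∣ acyclic G))
    where
    meet : η ∩ ⋃ P ≡ f
    meet = ⊆-antisym (old-vertices acyclic G a) (f⊆η∩⋃ a)

  -- The hypothesis makes each step add a vertex, so the simplex of a cycle attached last meets the
  -- others only inside f. But it shares with them two distinct links σ', or, when it is η 1 or η r,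
  -- one link σ' and σ 1; then σ 1 ⊆ f ≡ σ' lies in η 2 or η (r - 1), which is excluded.
  no-cycle-in-grown : ∀ {P} → Grown K d P → length P + suc d ≤ ∣ ⋃ P ∣ →
    ∀ {m r σ η} → CycleSeq m (suc d) K r σ η → ¬ (∀ k → 1 ≤ k → k ≤ r → η k ∈ₗ P)
  no-cycle-in-grown (base _) _ (_ , _ , _ , η-inj , 3≤r , _) η∈
    with η∈ 1 ≤-refl (≤-trans (s≤s z≤n) 3≤r) | η∈ 2 (s≤s z≤n) (<⇒≤ 3≤r)
  ... | here eq₁ | here eq₂ =
    η-inj 1 2 ≤-refl (≤-trans (s≤s z≤n) 3≤r) (s≤s z≤n) (<⇒≤ 3≤r) (λ ()) (trans eq₁ (sym eq₂))
  no-cycle-in-grown (attach {θ} {f} {P} G a) large {r = r} {σ} {η}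
    C@((_ , _ , walk) , closes , _ , η-inj , 3≤r , σ₁⊈ , σ' , link , σ'-inj) η∈ =
    no-cycle-in-grown G large' C old
    where
    large' : length P + suc d ≤ ∣ ⋃ P ∣
    large' = +-cancelˡ-≤ 1 _ _ (≤-trans large
      (+-cancelʳ-≤ (suc d) _ _ (≤-trans (+-monoʳ-≤ _ (d<∣η∩⋃∣ a)) (≤-reflexive (attach-count a)))))
    -- `P` alone has at most `length P + suc d` vertices, so by `large` the last step adds one,
    -- which leaves at most `suc d` old vertices in `θ`.
    ∣meet∣≤ : ∣ θ ∩ ⋃ P ∣ ≤ suc d
    ∣meet∣≤ = +-cancelˡ-≤ (suc ∣ ⋃ P ∣) _ _ (≤-trans
      (+-monoˡ-≤ ∣ θ ∩ ⋃ P ∣ (≤-trans (s≤s (∣⋃grown∣≤ G)) large)) (≤-reflexive (attach-count a)))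
    meet : f ≡ θ ∩ ⋃ P
    meet = ⊆∧∣≤∣⇒≡ (f⊆η∩⋃ a) (subst (_ ≤_) (sym (a .∣f∣)) ∣meet∣≤)
    old-part : ∀ {A B} → A ⊆ θ → A ⊆ B → B ∈ₗ P → A ⊆ f
    old-part A⊆θ A⊆B B∈P x∈ = subst (_ ∈_) (sym meet) (x∈p∩q⁺ (A⊆θ x∈ , ∈⇒⊆⋃ B∈P (A⊆B x∈)))
    old-link : ∀ {A B} → ∣ A ∣ ≡ suc d → A ⊆ θ → A ⊆ B → B ∈ₗ P → A ≡ f
    old-link ∣A∣ A⊆θ A⊆B B∈P =
      ⊆∧∣≤∣⇒≡ (old-part A⊆θ A⊆B B∈P) (≤-reflexive (trans (a .∣f∣) (sym ∣A∣)))

    module _ (k : ℕ) (1≤k : 1 ≤ k) (k≤r : k ≤ r) (ηₖ≡θ : η k ≡ θ) where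
      others : ∀ j → 1 ≤ j → j ≤ r → j ≢ k → η j ∈ₗ P
      others j 1≤j j≤r j≢k with η∈ j 1≤j j≤r
      ... | there η∈P = η∈P
      ... | here ηⱼ≡θ = contradiction (trans ηⱼ≡θ (sym ηₖ≡θ)) (η-inj j k 1≤j j≤r 1≤k k≤r j≢k)
      ⊆θ : ∀ {A} → A ⊆ η k → A ⊆ θ
      ⊆θ = subst (_ ⊆_) ηₖ≡θ
      left-link : 2 ≤ k → σ' k ≡ f
      left-link 2≤k with link k 2≤k k≤r
      ... | (_ , size) , σ'⊆ , ⊆ηₖ , _ = old-link size (⊆θ ⊆ηₖ) σ'⊆
        (others (k ∸ 1) (∸-monoˡ-≤ 1 2≤k) (≤-trans (m∸n≤m k 1) k≤r)
          (<⇒≢ (∸-monoʳ-< {o = 0} (s≤s z≤n) 1≤k)))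
      right-link : k < r → σ' (suc k) ≡ f
      right-link k<r with link (suc k) (s≤s 1≤k) k<r
      ... | (_ , size) , ⊆ηₖ , σ'⊆ , _ = old-link size (⊆θ ⊆ηₖ) σ'⊆
        (others (suc k) (s≤s z≤n) k<r (λ ()))

    attached : ∀ k → 1 ≤ k → k ≤ r → η k ≢ θ
    attached k 1≤k k≤r ηₖ≡θ with m≤n⇒m<n∨m≡n 1≤k | m≤n⇒m<n∨m≡n k≤r
    ... | inj₁ 1<k | inj₁ k<r = σ'-inj k (suc k) 1<k k≤r (s≤s 1≤k) k<r (λ ())
      (trans (left-link k 1≤k k≤r ηₖ≡θ 1<k) (sym (right-link k 1≤k k≤r ηₖ≡θ k<r)))
    ... | inj₂ refl | inj₁ k<r = σ₁⊈ 2 ≤-refl (∸-monoˡ-≤ 1 3≤r) λ x∈ →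
      proj₁ (proj₂ (proj₂ (link 2 ≤-refl k<r))) (subst (_ ∈_) (sym (right-link 1 1≤k k≤r ηₖ≡θ k<r))
        (old-part (⊆θ 1 1≤k k≤r ηₖ≡θ (proj₁ (proj₂ (walk 1 ≤-refl k≤r))))
          (subst (_⊆ η r) closes (proj₂ (proj₂ (walk r k≤r ≤-refl))))
          (others 1 1≤k k≤r ηₖ≡θ r k≤r ≤-refl (λ { refl → <-irrefl refl k<r })) x∈))
    ... | inj₁ 1<k | inj₂ refl = σ₁⊈ (r ∸ 1) (∸-monoˡ-≤ 1 3≤r) ≤-refl λ x∈ →
      proj₁ (proj₂ (link r 1<k k≤r)) (subst (_ ∈_) (sym (left-link r 1≤k k≤r ηₖ≡θ 1<k))
        (old-part (⊆θ r 1≤k k≤r ηₖ≡θ (subst (_⊆ η r) closes (proj₂ (proj₂ (walk r 1≤k ≤-refl)))))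
          (proj₁ (proj₂ (walk 1 ≤-refl 1≤k)))
          (others r 1≤k k≤r ηₖ≡θ 1 ≤-refl 1≤k (<⇒≢ 1<k)) x∈))
    ... | inj₂ refl | inj₂ refl = contradiction 3≤r λ { (s≤s ()) }

    old : ∀ k → 1 ≤ k → k ≤ r → η k ∈ₗ P
    old k 1≤k k≤r with η∈ k 1≤k k≤r
    ... | there η∈P = η∈P
    ... | here ηₖ≡θ = contradiction ηₖ≡θ (attached k 1≤k k≤r)

-- Components and a lower bound on the number of facets

module Components {p} (K : SimplicialComplex p) (d : ℕ) {S : List (Subset p)}
  (S-unique : Unique S) (S-simplex : ∀ {θ} → θ ∈ₗ S → IsSimplex K (suc d) θ) where

  -- By `separated` no simplex left over is adjacent to `part`, so `part` and `rest` have no common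
  -- facet and their facet counts add up.
  record Component : Set where
    field
      {part rest} : List (Subset p)
      grown       : Grown K d part
      split       : part ++ rest ↭ S
      separated   : ∀ {η g} → η ∈ₗ rest → ∣ g ∣ ≡ suc d → g ⊆ η → ¬ g ⊆ₛ part

    part⊆S : ∀ {θ} → θ ∈ₗ part → θ ∈ₗ S
    part⊆S = ∈-resp-↭ split ∘ ∈-++⁺ˡ

    rest⊆S : ∀ {θ} → θ ∈ₗ rest → θ ∈ₗ S
    rest⊆S = ∈-resp-↭ split ∘ ∈-++⁺ʳ part

    rest-unique : Unique rest
    rest-unique = Unique-++⁻ʳ part (Unique-resp-↭ (setoid _) (↭⇒↭ₛ (↭-sym split)) S-unique)

    length-split : length part + length rest ≡ length S
    length-split = trans (sym (length-++ part)) (↭-length split)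

  -- Greedy growth: a remaining simplex with a facet in `P` is attached, until there is none. `k`
  -- counts the remaining ones and makes the recursion structural.
  grow : ∀ k {P R} → length R ≡ k → Grown K d P → P ++ R ↭ S → Component
  grow k {P} {R} ∣R∣ G perm with any? (λ η → any? (_⊆ₛ? P) (facets η)) R
  ... | no none = record
    { grown = G ; split = perm
    ; separated = λ η∈ ∣g∣ g⊆η g⊆P → none (lose η∈ (lose (∈-facets⁺ g⊆η
        (trans (cong suc ∣g∣) (sym (proj₂ (S-simplex (∈-resp-↭ perm (∈-++⁺ʳ P η∈))))))) g⊆P)) }
  ... | yes some with find some
  ...   | η , η∈R , touch with find touch | ∈-∃++ η∈R
  ...     | f , f∈η , f⊆P | as , bs , refl = grow' k ∣R∣
    where
    perm' : η ∷ P ++ as ++ bs ↭ S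
    perm' = ↭-trans (↭-trans (prep η (↭-reflexive (sym (++-assoc P as bs))))
      (↭-trans (↭-sym (shift η (P ++ as) bs)) (↭-reflexive (++-assoc P as (η ∷ bs))))) perm
    simplex : IsSimplex K (suc d) η
    simplex = S-simplex (∈-resp-↭ perm' (here refl))
    fresh : η ∉ₗ P
    fresh η∈P with Unique-resp-↭ (setoid _) (↭⇒↭ₛ (↭-sym perm')) S-unique
    ... | η∉ ∷ _ = All.lookup η∉ (∈-++⁺ˡ η∈P) refl
    a : Attaches K d P η f
    a = let f⊆η , eq = ∈-facets⁻ η f∈η in record
      { simplex = simplex ; fresh = fresh ; ∣f∣ = suc-injective (trans eq (proj₂ simplex))
      ; f⊆η = f⊆η ; f⊆P = f⊆P }
    grow' : ∀ k → length (as ++ η ∷ bs) ≡ k → Component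
    grow' zero eq = contradiction (trans (sym (↭-length (shift η as bs))) eq) λ ()
    grow' (suc k) eq =
      grow k (suc-injective (trans (sym (↭-length (shift η as bs))) eq)) (attach G a) perm'

component : ∀ {p} (K : SimplicialComplex p) d {S} (u : Unique S)
  (simplex : ∀ {θ} → θ ∈ₗ S → IsSimplex K (suc d) θ) → 0 < length S →
  Components.Component K d u simplex
component K d {η ∷ R} u simplex _ =
  Components.grow K d u simplex (length R) refl (base (simplex (here refl))) ↭-refl

open FacetsWithin

module _ {p} {K : SimplicialComplex p} {d m : ℕ}
  (m≤d : m ≤ d) (acyclic : NoCycles m (suc d) K) where

  open Components.Component using () renaming (rest to restOf)

  -- `part` has `n` facets per simplex and one extra, `rest` has at least `n` per simplex and one
  -- extra, and `separated` makes the two families disjoint. Hence the surplus of two.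
  two-components : ∀ {S} {u : Unique S} {simplex : ∀ {θ} → θ ∈ₗ S → IsSimplex K (suc d) θ}
    (C : Components.Component K d u simplex) → ∀ {L} → FacetsWithin d (restOf C) L →
    suc (suc d * length (restOf C)) ≤ length L →
    ∃ λ L' → FacetsWithin d S L' × suc (suc (suc d * length S)) ≤ length L'
  two-components {S} C {L} F ∣L∣≥
    with facets-of-grown m≤d acyclic (Components.Component.grown C)
  ... | M , E , ∣M∣ = M ++ L , record
    { distinct = Unique.++⁺ (E-part .distinct) (E-rest .distinct) disjoint
    ; sound = λ g∈ → [ E-part .sound , E-rest .sound ]′ (∈-++⁻ M g∈)
    } , ≤-trans (≤-reflexive size)
          (≤-trans (+-monoʳ-≤ (length M) ∣L∣≥) (≤-reflexive (sym (length-++ M))))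
    where
    open Components.Component C
    E-part : FacetsWithin d S M
    E-part = FacetsWithin-mono part⊆S (FacetsOf.within E)
    E-rest : FacetsWithin d S L
    E-rest = FacetsWithin-mono rest⊆S F
    disjoint : ∀ {g} → ¬ (g ∈ₗ M × g ∈ₗ L)
    disjoint (g∈M , g∈L) with find (proj₂ (F .sound g∈L))
    ... | θ , θ∈ , g⊆θ = separated θ∈ (proj₁ (F .sound g∈L)) g⊆θ (proj₂ (FacetsOf.sound E g∈M))
    size : suc (suc (suc d * length S)) ≡ length M + suc (suc d * length rest)
    size = trans (cong (2 +_)
        (trans (cong (suc d *_) (sym length-split)) (*-distribˡ-+ (suc d) (length part) _)))
      (sym (trans (cong (_+ suc (suc d * length rest)) ∣M∣) (+-suc (suc (suc d * length part)) _)))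

  -- Each component contributes a surplus of one. Splitting off a component leaves a shorter list,
  -- and `k` bounds the length.
  many-facets : ∀ k {S} → length S ≤ k → Unique S → (∀ {θ} → θ ∈ₗ S → IsSimplex K (suc d) θ) →
    0 < length S → ∃ λ L → FacetsWithin d S L × suc (suc d * length S) ≤ length L
  many-facets zero ∣S∣≤ _ _ 0<∣S∣ = contradiction (≤-trans 0<∣S∣ ∣S∣≤) λ ()
  many-facets (suc k) {S} ∣S∣≤ u simplex 0<∣S∣ = go _ refl
    where
    open Components K d u simplex
    C : Component
    C = component K d u simplex 0<∣S∣
    open Component C
    go : ∀ R → rest ≡ R → ∃ λ L → FacetsWithin d S L × suc (suc d * length S) ≤ length L
    go [] none with facets-of-grown m≤d acyclic grown
    ... | L , E , ∣L∣ = L , FacetsWithin-mono part⊆S (FacetsOf.within E) ,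
      ≤-reflexive (trans (cong (λ n → suc (suc d * n)) ∣S∣) (sym ∣L∣))
      where
      ∣S∣ : length S ≡ length part
      ∣S∣ = trans (sym length-split)
        (trans (cong (λ R → length part + length R) none) (+-identityʳ _))
    go (_ ∷ _) some with many-facets k (≤-pred (≤-trans smaller ∣S∣≤)) rest-unique
                           (simplex ∘ rest⊆S)
                           (subst (λ R → 0 < length R) (sym some) (s≤s z≤n))
      where
      smaller : length rest < length S
      smaller = subst (length rest <_) length-split
        (m<n+m _ (∈-length (proj₂ (Grown-inhabited grown))))
    ... | L , F , ∣L∣≥ with two-components C F ∣L∣≥
    ...   | L' , F' , ∣L'∣≥ = L' , F' , <⇒≤ ∣L'∣≥

-- Pure complexes with one component

module Pure {p} (K : SimplicialComplex p) (d : ℕ) (pure : IsPure (suc d) K) where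

  -- By definition their lengths are `α (suc d) K` and `α d K`.
  tops links : List (Subset p)
  tops = filter (λ s → ∣ s ∣ ≟ suc (suc d)) (simplices K)
  links = filter (λ s → ∣ s ∣ ≟ suc d) (simplices K)

  tops⁺ : ∀ {θ} → IsSimplex K (suc d) θ → θ ∈ₗ tops
  tops⁺ (θ∈ , ∣θ∣) = ∈-filter⁺ _ θ∈ ∣θ∣

  tops⁻ : ∀ {θ} → θ ∈ₗ tops → IsSimplex K (suc d) θ
  tops⁻ θ∈ = ∈-filter⁻ (λ s → ∣ s ∣ ≟ suc (suc d)) {xs = simplices K} θ∈

  tops-unique : Unique tops
  tops-unique = Unique.filter⁺ _ (unique K)

  links-unique : Unique links
  links-unique = Unique.filter⁺ _ (unique K)

  -- Purity enters here, so that counting the facets of n-simplices counts all of `links`.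
  links⁻ : ∀ {g} → g ∈ₗ links → ∣ g ∣ ≡ suc d × g ⊆ₛ tops
  links⁻ g∈ with ∈-filter⁻ (λ s → ∣ s ∣ ≟ suc d) {xs = simplices K} g∈
  ... | g∈K , ∣g∣ with proj₂ pure g∈K
  ...   | θ , θ-simplex , g⊆θ = ∣g∣ , lose (tops⁺ θ-simplex) g⊆θ

  links⁺ : ∀ {g} → ∣ g ∣ ≡ suc d → g ⊆ₛ tops → g ∈ₗ links
  links⁺ ∣g∣ g⊆ with find g⊆
  ... | θ , θ∈ , g⊆θ = ∈-filter⁺ _ (proj₁ (⊆⇒IsSimplex K (tops⁻ θ∈) g⊆θ ∣g∣)) ∣g∣

  0<tops : 0 < length tops
  0<tops with tops | tops⁺ (proj₂ (proj₁ (proj₁ pure)))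
  ... | _ ∷ _ | _ = s≤s z≤n

  open Components K d tops-unique tops⁻

  C : Component
  C = component K d tops-unique tops⁻ 0<tops
  open Component C

  module Whole (whole : ∀ {θ} → θ ∈ₗ tops → θ ∈ₗ part) where

    ⋃part : ∣ ⋃ part ∣ ≡ p
    ⋃part = trans (cong ∣_∣ (⊆-antisym (⊆-max _) λ {x} _ → covered x)) (∣⊤∣≡n p)
      where
      covered : ∀ x → x ∈ ⋃ part
      covered x with proj₂ pure (singletons K x)
      ... | θ , θ-simplex , x⊆θ = ∈⇒⊆⋃ (whole (tops⁺ θ-simplex)) (x⊆θ (x∈⁅x⁆ x))

    length-links : ∀ {m} → m ≤ d → NoCycles m (suc d) K → length links ≡ suc (suc d * length part)
    length-links m≤d acyclic with facets-of-grown m≤d acyclic grown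
    ... | L , E , ∣L∣ = trans (Unique-⊆⊇⇒length≡ links-unique (FacetsOf.distinct E)
      (λ g∈ → let ∣g∣ , g⊆ = links⁻ g∈ in FacetsOf.complete E ∣g∣ (Any-resp-⊆ whole g⊆))
      (λ g∈ → let ∣g∣ , g⊆ = FacetsOf.sound E g∈ in links⁺ ∣g∣ (Any-resp-⊆ part⊆S g⊆))) ∣L∣

    connected : Connected (suc d) K
    connected τ τ' (τ∈ , ∣τ∣) (τ'∈ , ∣τ'∣) τ≢τ'
      with Grown⇒Linked grown ∣τ∣ ∣τ'∣ (in-part τ∈ ∣τ∣) (in-part τ'∈ ∣τ'∣) τ≢τ'
      where
      in-part : ∀ {τ} → τ ∈ₗ simplices K → ∣ τ ∣ ≡ suc d → τ ⊆ₛ part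
      in-part τ∈ ∣τ∣ = Any-resp-⊆ whole (proj₂ (links⁻ (∈-filter⁺ _ τ∈ ∣τ∣)))
    ... | r , σ , η , path , start , end =
      r , σ , η , Path⇒PathSeq (Grown⇒IsSimplex grown) path , start , end

    acyclic-of-vertices : length part + suc d ≡ p → Acyclic (suc d) K
    acyclic-of-vertices eq m m<n r σ η cycle =
      no-cycle-in-grown grown (≤-reflexive (trans eq (sym ⋃part))) cycle
        (λ k 1≤k k≤r → whole (tops⁺ (proj₁ (proj₂ (proj₁ cycle)) k 1≤k k≤r)))

  part-closed : ∀ {g θ} → IsSimplex K d g → g ⊆ₛ part → IsSimplex K (suc d) θ → g ⊆ θ → θ ∈ₗ part
  part-closed (_ , ∣g∣) g⊆P θ-simplex g⊆θ with ∈-++⁻ part (∈-resp-↭ (↭-sym split) (tops⁺ θ-simplex))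
  ... | inj₁ θ∈P = θ∈P
  ... | inj₂ θ∈R = contradiction g⊆P (separated θ∈R ∣g∣ g⊆θ)

  facet-of : ∀ {θ} → IsSimplex K (suc d) θ → ∃ λ g → IsSimplex K d g × g ⊆ θ
  facet-of s with subset-through (suc d) (proj₂ (∣∣≡suc⇒Nonempty (proj₂ s))) (s≤s z≤n)
                    (≤-trans (n≤1+n _) (≤-reflexive (sym (proj₂ s))))
  ... | g , _ , g⊆θ , ∣g∣ = g , ⊆⇒IsSimplex K s g⊆θ ∣g∣ , g⊆θ

  walk-in-part : ∀ {r σ η} → Walk d (suc d) K r σ η → σ 1 ⊆ₛ part → ∀ k → k ≤ r → σ (suc k) ⊆ₛ part
  walk-in-part W σ₁⊆ zero _ = σ₁⊆
  walk-in-part W@(σ-simplex , η-simplex , inc) σ₁⊆ (suc k) k<r with inc (suc k) (s≤s z≤n) k<r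
  ... | _ , left , right = lose
    (part-closed (σ-simplex (suc k) (s≤s z≤n) (m≤n⇒m≤1+n k<r)) (walk-in-part W σ₁⊆ k (<⇒≤ k<r))
      (η-simplex (suc k) (s≤s z≤n) k<r) left) right

  -- A path from a facet of a simplex in `part` to a facet of `θ` never leaves `part`, by
  -- `part-closed` at each step.
  connected⇒whole : Connected (suc d) K → ∀ {θ} → θ ∈ₗ tops → θ ∈ₗ part
  connected⇒whole conn {θ} θ∈ with Grown-inhabited grown
  ... | η , η∈P with facet-of (Grown⇒IsSimplex grown η∈P) | facet-of (tops⁻ θ∈)
  ...   | g , g-simplex , g⊆η | h , h-simplex , h⊆θ = part-closed h-simplex h⊆P (tops⁻ θ∈) h⊆θ
    where
    h⊆P : h ⊆ₛ part
    h⊆P with g ≟ˢ h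
    ... | yes refl = lose η∈P g⊆η
    ... | no g≢h with conn g h g-simplex h-simplex g≢h
    ...   | r , σ , ζ , (W , _) , refl , refl = walk-in-part W (lose η∈P g⊆η) r ≤-refl

  -- A simplex left in `rest` would give a second component, hence a surplus of two facets, while
  -- the prescribed count allows one.
  count⇒whole : ∀ {m} → m ≤ d → NoCycles m (suc d) K → length links ≡ suc (suc d * length tops) →
    ∀ {θ} → θ ∈ₗ tops → θ ∈ₗ part
  count⇒whole m≤d acyclic count {θ} θ∈ with ∈-++⁻ part (∈-resp-↭ (↭-sym split) θ∈)
  ... | inj₁ θ∈P = θ∈P
  ... | inj₂ θ∈R with many-facets {K = K} m≤d acyclic _ ≤-refl rest-unique (tops⁻ ∘ rest⊆S)
                        (∈-length θ∈R)
  ...   | L , F , ∣L∣≥ with two-components m≤d acyclic C F ∣L∣≥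
  ...     | L' , F' , ∣L'∣≥ = contradiction
    (≤-trans ∣L'∣≥ (≤-trans (Unique-⊆⇒length≤ (F' .distinct)
      (λ g∈ → let ∣g∣ , g⊆ = F' .sound g∈ in links⁺ ∣g∣ g⊆)) (≤-reflexive count)))
    (<-irrefl refl)

  length-tops : (∀ {θ} → θ ∈ₗ tops → θ ∈ₗ part) → length tops ≡ length part
  length-tops whole = ≤-antisym (Unique-⊆⇒length≤ tops-unique whole)
    (≤-trans (m≤m+n (length part) (length rest)) (≤-reflexive length-split))

-- The equivalence

theorem5p5 : (n p : ℕ) → 1 ≤ n → (K : SimplicialComplex p) → IsPure n K →
    (IsSimplicialTree n K →
    (∃ λ m → m < n × NoCycles m n K) × α (n ∸ 1) K ≡ (p ∸ n) * n + 1 × α n K ≡ p ∸ n)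
    × ((∃ λ m → m < n × NoCycles m n K) × α (n ∸ 1) K ≡ (p ∸ n) * n + 1 × α n K ≡ p ∸ n →
    IsSimplicialTree n K)
theorem5p5 (suc d) p _ K pure = tree⇒count , count⇒tree
  where
  open Pure K d pure
  open Components.Component C
  n : ℕ
  n = suc d

  facet-count : ∀ {N} → N ≡ p ∸ n → suc (n * N) ≡ (p ∸ n) * n + 1
  facet-count {N} refl = trans (cong suc (*-comm n N)) (+-comm 1 (N * n))

  tree⇒count : IsSimplicialTree n K →
    (∃ λ m → m < n × NoCycles m n K) × α d K ≡ (p ∸ n) * n + 1 × α n K ≡ p ∸ n
  tree⇒count (_ , connected , acyclic) =
    -- A tree satisfies the first condition for any `m < n`; `m = 0` also yields the vertex count.
    (0 , s≤s z≤n , acyclic₀) , trans (length-links z≤n acyclic₀) (facet-count ∣part∣)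
                             , trans (length-tops whole) ∣part∣
    where
    whole : ∀ {θ} → θ ∈ₗ tops → θ ∈ₗ part
    whole = connected⇒whole connected
    open Whole whole
    acyclic₀ : NoCycles 0 n K
    acyclic₀ = acyclic 0 (s≤s z≤n)
    ∣part∣ : length part ≡ p ∸ n
    ∣part∣ = sym (trans (cong (_∸ n) (trans (sym ⋃part) (∣⋃grown∣ acyclic₀ grown)))
                        (m+n∸n≡m (length part) n))

  count⇒tree : (∃ λ m → m < n × NoCycles m n K) × α d K ≡ (p ∸ n) * n + 1 × α n K ≡ p ∸ n →
    IsSimplicialTree n K
  count⇒tree ((_ , s≤s m≤d , acyclic) , ∣links∣ , ∣tops∣) =
    pure , connected , acyclic-of-vertices
      (trans (cong (_+ n) (trans (sym (length-tops whole)) ∣tops∣)) (m∸n+n≡m n≤p))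
    where
    whole : ∀ {θ} → θ ∈ₗ tops → θ ∈ₗ part
    whole = count⇒whole m≤d acyclic (trans ∣links∣ (sym (facet-count ∣tops∣)))
    open Whole whole
    -- `p ∸ n + n` gives back `p` only for `n ≤ p`; an n-simplex supplies the vertices.
    n≤p : n ≤ p
    n≤p with proj₁ (proj₁ pure)
    ... | η , _ , ∣η∣ = ≤-trans (n≤1+n n) (≤-trans (≤-reflexive (sym ∣η∣)) (∣p∣≤n η))
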